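{- Fix a finite presentation $G=\langle a_1,\dots,a_d\mid r_1,\dots,r_q\rangle$ and let $M=2d+q$ be the number of its law terms. Let $D_{G,w}(n)$ be the dispersion of the instance associated to $G$ and $w$, as defined in the context. For every nonempty signed word $w$ of length $L$ (the number of letters as written, without cancellation) and every integer $n>L$, $$ n(n-1)-Mn\le D_{G,w}(n)\le n(n-1).$$ An interpretation on an $n$-element alphabet whose allowed output image has at least $n(n-1)-Mn$ elements is explicitly computable and uses only cyclic shifts (every function symbol is interpreted as a cyclic shift of the alphabet). In particular, for each such word $w$, $$\lim_{n\to\infty}\frac{D_{G,w}(n)}{n(n-1)}=1,\qquad D_{G,w}(n)=n^2-O_G(n),$$ where the constant in the error bound depends only on the presentation, while the condition $n>L$ also depends on the word. (The lower bound is an integer inequality and may be negative.)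
   Context: Signed words are finite sequences $v=\ell_1\cdots\ell_L$ of letters from $\{a_1^{\pm1},\dots,a_d^{\pm1}\}$, not assumed freely reduced; the relators $r_j$ are signed words. For each generator $a_i$ introduce two unary function symbols $p_i,m_i$. An interpretation on a set $A$ assigns to each of these $2d$ symbols an arbitrary function $A\to A$ (in particular $p_i,m_i$ need not be interpreted as inverse functions). For a signed word $v=\ell_1\cdots\ell_L$ define the term $\tau_v(x)=f_{\ell_1}(f_{\ell_2}(\cdots f_{\ell_L}(x)\cdots))$, where $f_{a_i}=p_i$, $f_{a_i^{ -1}}=m_i$, and $\tau_v(x)=x$ for the empty word $v$. The list $\mathcal L_G$ of law terms consists of the $M=2d+q$ terms $p_i(m_i(x))$, $m_i(p_i(x))$ for $1\le i\le d$ and $\tau_{r_j}(x)$ for $1\le j\le q$ (repetitions retained). The instance associated to $G,w$ has the two variables $x,y$, output tuple $(x,y)$, and the tests $x\ne y$; $L(x)\ne y$ for each $L\in\mathcal L_G$; $\tau_w(x)\ne x$. For an interpretation on a finite set $A$, the allowed output image is the set of pairs $(a,b)\in A^2$ which satisfy all these tests when $x=a$, $y=b$. For $n\ge1$, $D_{G,w}(n)$ is the maximum of the cardinality of this set over all interpretations on an $n$-element set. A cyclic shift is a map of the form $z\mapsto z+c$ on $\mathbb Z/n\mathbb Z$. -}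

module Defs where

open import Data.Fin.Base using (Fin; toℕ; finToFun; funToFin)
open import Data.Fin.Properties using (finToFun-funToFin) renaming (_≟_ to _≟ᶠ_)
import Data.Integer.Base as ℤ
open import Data.List.Base
  using (List; _++_; map; foldr; length; filter; allFin;
         cartesianProduct; cartesianProductWith)
open import Data.List.Extrema.Nat using (max; argmax-sel; v≤max⁺)
open import Data.List.Membership.Propositional using (_∈_; lose)
open import Data.List.Membership.Propositional.Properties
  using (∈-allFin; ∈-cartesianProductWith⁺; ∈-map⁺; ∈-map⁻)
open import Data.List.Properties using (filter-≐; length-++; length-map; length-tabulate)
open import Data.List.Relation.Unary.All as All using (All)
open import Data.Nat.Base using (ℕ; suc; _+_; _*_; _∸_; _^_; _≤_; _≥_; z≤n)
open import Data.Nat.DivMod using (_mod_)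
open import Data.Nat.Properties using (≤-reflexive; ≤-antisym; ≤-trans; +-assoc; +-identityʳ)
open import Data.Product.Base using (∃; _×_; _,_)
open import Data.Rational.Base as ℚ using (ℚ; 0ℚ; _/_)
open import Data.Sum.Base using (inj₁; inj₂)
open import Function.Base using (_∘_)
open import Relation.Binary.PropositionalEquality
  using (_≡_; _≢_; _≗_; refl; sym; trans; cong; cong₂; module ≡-Reasoning)
open import Relation.Nullary.Decidable using (¬?; _×-dec_)
open import Relation.Unary using (Pred; Decidable)
open import Level using (0ℓ)

data Letter (d : ℕ) : Set where
  a a⁻¹ : Fin d → Letter d

-- Signed words are not assumed freely reduced.
Word : ℕ → Set
Word d = List (Letter d)

record Presentation : Set where
  field
    d q     : ℕ
    relator : Fin q → Word d

data Symbol (d : ℕ) : Set where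
  p m : Fin d → Symbol d

infixr 6 _·_

data Term (d : ℕ) : Set where
  var : Term d
  _·_ : Symbol d → Term d → Term d

symbol : ∀ {d} → Letter d → Symbol d
symbol (a i)   = p i
symbol (a⁻¹ i) = m i

τ : ∀ {d} → Word d → Term d
τ = foldr (λ ℓ t → symbol ℓ · t) var

-- No relation is imposed between the functions interpreting p i and m i.
Interpretation : ℕ → Set → Set
Interpretation d A = Symbol d → A → A

⟦_⟧ : ∀ {d A} → Term d → Interpretation d A → A → A
⟦ var ⟧   I z = z
⟦ s · t ⟧ I z = I s (⟦ t ⟧ I z)

module _ (G : Presentation) where
  open Presentation G

  laws : List (Term d)
  laws = map (λ i → p i · m i · var) (allFin d)
      ++ map (λ i → m i · p i · var) (allFin d)
      ++ map (τ ∘ relator) (allFin q)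

  numLaws : ℕ
  numLaws = 2 * d + q

  length-laws : length laws ≡ numLaws
  length-laws = begin
    length laws        ≡⟨ length-++ (map (λ i → p i · m i · var) (allFin d)) ⟩
    _                  ≡⟨ cong₂ _+_ (len d) (length-++ (map (λ i → m i · p i · var) (allFin d))) ⟩
    d + _              ≡⟨ cong (d +_) (cong₂ _+_ (len d) (len q)) ⟩
    d + (d + q)        ≡⟨ +-assoc d d q ⟨
    d + d + q          ≡⟨ cong (λ e → d + e + q) (+-identityʳ d) ⟨
    2 * d + q          ∎
    where
    open ≡-Reasoning
    len : ∀ k {f : Fin k → Term d} → length (map f (allFin k)) ≡ k
    len k {f} = trans (length-map f (allFin k)) (length-tabulate {n = k} (λ i → i))

  module _ (w : Word d) where

    Allowed : ∀ {A} → Interpretation d A → Pred (A × A) 0ℓ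
    Allowed I (x , y) =
      x ≢ y × All (λ L → ⟦ L ⟧ I x ≢ y) laws × ⟦ τ w ⟧ I x ≢ x

    allowed? : ∀ {n} (I : Interpretation d (Fin n)) → Decidable (Allowed I)
    allowed? I (x , y) =
      ¬? (x ≟ᶠ y) ×-dec All.all? (λ L → ¬? (⟦ L ⟧ I x ≟ᶠ y)) laws ×-dec ¬? (⟦ τ w ⟧ I x ≟ᶠ x)

    outputImage : ∀ {n} → Interpretation d (Fin n) → List (Fin n × Fin n)
    outputImage {n} I = filter (allowed? I) (cartesianProduct (allFin n) (allFin n))

    imageSize : ∀ {n} → Interpretation d (Fin n) → ℕ
    imageSize I = length (outputImage I)

-- A function Fin n → Fin n is coded by an element of Fin (n ^ n), so each of
-- the families p, m : Fin d → (Fin n → Fin n) is coded by one of Fin ((n ^ n) ^ d).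
decode : ∀ {d n} → Fin ((n ^ n) ^ d) → Fin ((n ^ n) ^ d) → Interpretation d (Fin n)
decode {d} {n} c e (p i) = finToFun {n} {n} (finToFun {n ^ n} {d} c i)
decode {d} {n} c e (m i) = finToFun {n} {n} (finToFun {n ^ n} {d} e i)

-- All interpretations on Fin n, each occurring once up to pointwise equality.
interpretations : ∀ d n → List (Interpretation d (Fin n))
interpretations d n = cartesianProductWith decode (allFin _) (allFin _)

-- The value 0 supplied to max is only a default: the list is never empty, and
-- imageSize≤dispersion and dispersion-attained below show that this is the maximum.
dispersion : (G : Presentation) → Word (Presentation.d G) → ℕ → ℕ
dispersion G w n = max 0 (map (imageSize G w) (interpretations (Presentation.d G) n))

interpretations-complete : ∀ {d n} (I : Interpretation d (Fin n)) →
  ∃ λ J → J ∈ interpretations d n × (∀ s → J s ≗ I s)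
interpretations-complete {d} {n} I =
  decode c e , ∈-cartesianProductWith⁺ decode (∈-allFin c) (∈-allFin e) , decodes
  where
  c = funToFin {d} (λ i → funToFin (I (p i)))
  e = funToFin {d} (λ i → funToFin (I (m i)))

  decodes : ∀ s → decode c e s ≗ I s
  decodes (p i) z = trans
    (cong (λ k → finToFun {n} {n} k z) (finToFun-funToFin {d} (λ i → funToFin (I (p i))) i))
    (finToFun-funToFin (I (p i)) z)
  decodes (m i) z = trans
    (cong (λ k → finToFun {n} {n} k z) (finToFun-funToFin {d} (λ i → funToFin (I (m i))) i))
    (finToFun-funToFin (I (m i)) z)

⟦⟧-cong : ∀ {d A} {I J : Interpretation d A} → (∀ s → I s ≗ J s) →
          ∀ t → ⟦ t ⟧ I ≗ ⟦ t ⟧ J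
⟦⟧-cong         I≗J var     z = refl
⟦⟧-cong {I = I} I≗J (s · t) z = trans (cong (I s) (⟦⟧-cong I≗J t z)) (I≗J s _)

module _ (G : Presentation) (w : Word (Presentation.d G)) where
  open Presentation G

  allowed-cong : ∀ {A} {I J : Interpretation d A} → (∀ s → I s ≗ J s) →
                 ∀ {xy} → Allowed G w I xy → Allowed G w J xy
  allowed-cong I≗J {x , y} (x≢y , laws≢ , w≢) =
    x≢y ,
    All.map (λ {L} ne eq → ne (trans (⟦⟧-cong I≗J L x) eq)) laws≢ ,
    (λ eq → w≢ (trans (⟦⟧-cong I≗J (τ w) x) eq))

  imageSize-cong : ∀ {n} {I J : Interpretation d (Fin n)} → (∀ s → I s ≗ J s) →
                   imageSize G w I ≡ imageSize G w J
  imageSize-cong {n} {I} {J} I≗J = cong length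
    (filter-≐ (allowed? G w I) (allowed? G w J)
      (allowed-cong I≗J , allowed-cong (λ s z → sym (I≗J s z)))
      (cartesianProduct (allFin n) (allFin n)))

  imageSize≤dispersion : ∀ {n} (I : Interpretation d (Fin n)) →
                         imageSize G w I ≤ dispersion G w n
  imageSize≤dispersion {n} I with interpretations-complete I
  ... | J , J∈ , J≗I = v≤max⁺ 0 _ (inj₂
    (lose (∈-map⁺ (imageSize G w) J∈) (≤-reflexive (sym (imageSize-cong J≗I)))))

  dispersion-attained : ∀ n → ∃ λ (I : Interpretation d (Fin n)) →
                        imageSize G w I ≡ dispersion G w n
  dispersion-attained n
    with argmax-sel (λ k → k) 0 (map (imageSize G w) (interpretations d n))
  ... | inj₂ D∈ with ∈-map⁻ (imageSize G w) D∈
  ...   | I , _ , D≡ = I , sym D≡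
  dispersion-attained n | inj₁ D≡0 = I₀ ,
    ≤-antisym (imageSize≤dispersion I₀) (≤-trans (≤-reflexive D≡0) z≤n)
    where
    I₀ : Interpretation d (Fin n)
    I₀ _ z = z

-- ℤ/nℤ has carrier Fin n.
shift : ∀ {n} → Fin n → Fin n → Fin n
shift {n@(suc _)} c z = (toℕ z + toℕ c) mod n

IsCyclicShift : ∀ {n} → (Fin n → Fin n) → Set
IsCyclicShift f = ∃ λ c → f ≗ shift c

-- n (n ∸ 1) vanishes for n ≤ 1, where the ratio is given the junk value 0; this
-- does not affect the limit.
dispersionRatio : (G : Presentation) → Word (Presentation.d G) → ℕ → ℚ
dispersionRatio G w n@(suc (suc _)) = ℤ.+ dispersion G w n / (n * (n ∸ 1))
dispersionRatio G w _               = 0ℚ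

-- For a rational sequence with a rational limit, rational ε give the same
-- notion of convergence as real ε.
_⟶_ : (ℕ → ℚ) → ℚ → Set
u ⟶ l = ∀ ε → 0ℚ ℚ.< ε → ∃ λ N → ∀ n → n ≥ N → ℚ.∣ u n ℚ.- l ∣ ℚ.< ε

{-# OPTIONS --safe #-}
-- Interpret every symbol as the shift by 1. Then τ w is the shift by the length
-- of w, which has no fixed point because 0 < length w < n. For each x, the
-- remaining tests exclude at most 1 + numLaws values of y, and always exclude y = x.
module Submission where

open import Defs
open import Data.Bool.Base using (true; false)
open import Data.Fin.Base using (Fin; zero; suc; toℕ)
open import Data.Fin.Properties using (injective⇒≤; toℕ<n; toℕ-fromℕ<) renaming (_≟_ to _≟ᶠ_)
open import Data.Integer.Base as ℤ using (+_; +[1+_]; -1ℤ; +<+; ∣_∣)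
import Data.Integer.Properties as ℤ
open import Data.List.Base
  using (List; []; _∷_; _++_; map; filter; length; allFin; cartesianProduct)
open import Data.List.Membership.Propositional using (_∈_; _∉_; lose)
open import Data.List.Membership.Propositional.Properties
  using (∈-allFin; ∈-filter⁺; ∈-++⁺ˡ; ∈-++⁺ʳ; ∈-map⁺)
open import Data.List.Membership.DecPropositional using (_∈?_)
import Data.List.Membership.Setoid.Properties as Membership
open import Data.List.Properties
  using (filter-++; filter-notAll; length-++; length-map; length-tabulate)
import Data.List.Relation.Unary.All as All
open import Data.List.Relation.Unary.Any using (index; here; there)
open import Data.Nat.Base
  using (ℕ; zero; suc; _+_; _*_; _∸_; _^_; _≤_; _<_; z≤n; s≤s; NonZero)
open import Data.Nat.Coprimality using (Coprime)
open import Data.Nat.DivMod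
  using (_%_; _/_; %-distribˡ-+; m%n%n≡m%n; m≡m%n+[m/n]*n; m<n⇒m%n≡m)
open import Data.Nat.Divisibility using (_∣_; divides-refl; >⇒∤)
open import Data.Nat.Properties
open import Data.Nat.ListAction using (sum)
open import Data.Product.Base using (∃; _×_; _,_)
import Data.Rational.Base as ℚ
open import Data.Rational.Base using (1ℚ; mkℚ)
import Data.Rational.Properties as ℚ
import Data.Rational.Unnormalised.Base as ℚᵘ
open import Data.Rational.Unnormalised.Base using (mkℚᵘ; *≡*; *<*)
import Data.Rational.Unnormalised.Properties as ℚᵘ
open import Function.Base using (_∘_)
open import Relation.Binary.PropositionalEquality
open import Relation.Nullary using (yes; no; does; contradiction)
open import Relation.Unary using (Pred; Decidable)

-- Counting in lists

length-allFin : ∀ n → length (allFin n) ≡ n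
length-allFin n = length-tabulate {n = n} (λ i → i)

-- Choosing for each `y` one position where it occurs gives an injection from `Fin n` into the
-- positions of `xs`. Repetitions in `xs` are harmless.
covering⇒≤length : ∀ {n} (xs : List (Fin n)) → (∀ y → y ∈ xs) → n ≤ length xs
covering⇒≤length xs cover = injective⇒≤ {f = λ y → index (cover y)}
  λ {x} {y} → Membership.index-injective (setoid _) (cover x) (cover y)

length-filter-map : ∀ {A B : Set} {ℓ} {P : Pred A ℓ} (P? : Decidable P) (f : B → A) xs →
  length (filter P? (map f xs)) ≡ length (filter (P? ∘ f) xs)
length-filter-map P? f []       = refl
length-filter-map P? f (x ∷ xs) with does (P? (f x))
... | true  = cong suc (length-filter-map P? f xs)
... | false = length-filter-map P? f xs

-- Fixing the first coordinate turns a count of pairs into a sum of row counts, so both bounds on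
-- the output image can be proved row by row.
length-filter-cartesianProduct :
  ∀ {A B : Set} {ℓ} {P : Pred (A × B) ℓ} (P? : Decidable P) xs ys →
  length (filter P? (cartesianProduct xs ys)) ≡
  sum (map (λ x → length (filter (P? ∘ (x ,_)) ys)) xs)
length-filter-cartesianProduct P? []       ys = refl
length-filter-cartesianProduct P? (x ∷ xs) ys = begin
  length (filter P? (map (x ,_) ys ++ cartesianProduct xs ys))
    ≡⟨ cong length (filter-++ P? (map (x ,_) ys) _) ⟩
  length (filter P? (map (x ,_) ys) ++ filter P? (cartesianProduct xs ys))
    ≡⟨ length-++ (filter P? (map (x ,_) ys)) ⟩
  length (filter P? (map (x ,_) ys)) + length (filter P? (cartesianProduct xs ys))
    ≡⟨ cong₂ _+_ (length-filter-map P? (x ,_) ys) (length-filter-cartesianProduct P? xs ys) ⟩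
  length (filter (P? ∘ (x ,_)) ys) + sum (map (λ x → length (filter (P? ∘ (x ,_)) ys)) xs)
    ∎
  where open ≡-Reasoning

module _ {A : Set} (f : A → ℕ) (k : ℕ) where

  sum-map-≤ : (∀ x → f x ≤ k) → ∀ xs → sum (map f xs) ≤ length xs * k
  sum-map-≤ f≤k []       = z≤n
  sum-map-≤ f≤k (x ∷ xs) = +-mono-≤ (f≤k x) (sum-map-≤ f≤k xs)

  sum-map-≥ : (∀ x → k ≤ f x) → ∀ xs → length xs * k ≤ sum (map f xs)
  sum-map-≥ k≤f []       = z≤n
  sum-map-≥ k≤f (x ∷ xs) = +-mono-≤ (k≤f x) (sum-map-≥ k≤f xs)

-- The list `zs` followed by the filtered list covers `Fin n`. Since `zs` may contain repetitions,
-- coinciding excluded values never have to be merged.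
length-filter-≥ : ∀ {n ℓ} {P : Pred (Fin n) ℓ} (P? : Decidable P) zs →
  (∀ {y} → y ∉ zs → P y) → n ≤ length zs + length (filter P? (allFin n))
length-filter-≥ {n} P? zs ∉⇒P =
  ≤-trans (covering⇒≤length (zs ++ filter P? (allFin n)) cover)
          (≤-reflexive (length-++ zs))
  where
  cover : ∀ y → y ∈ zs ++ filter P? (allFin n)
  cover y with _∈?_ _≟ᶠ_ y zs
  ... | yes y∈ = ∈-++⁺ˡ y∈
  ... | no  y∉ = ∈-++⁺ʳ zs (∈-filter⁺ P? (∈-allFin y) (∉⇒P y∉))

-- Bounds on the output image

module _ (G : Presentation) (w : Word (Presentation.d G)) where
  open Presentation G

  imageSize-≤ : ∀ {n} (I : Interpretation d (Fin n)) → imageSize G w I ≤ n * (n ∸ 1)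
  imageSize-≤ {n} I = begin
    imageSize G w I
      ≡⟨ length-filter-cartesianProduct (allowed? G w I) (allFin n) (allFin n) ⟩
    sum (map row (allFin n))    ≤⟨ sum-map-≤ row (n ∸ 1) row≤ (allFin n) ⟩
    length (allFin n) * (n ∸ 1) ≡⟨ cong (_* (n ∸ 1)) (length-allFin n) ⟩
    n * (n ∸ 1)                 ∎
    where
    open ≤-Reasoning
    row : Fin n → ℕ
    row x = length (filter (allowed? G w I ∘ (x ,_)) (allFin n))

    -- The value `y = x` fails the test `x ≢ y`, so each row loses at least one of its `n` entries.
    row≤ : ∀ x → row x ≤ n ∸ 1
    row≤ x = ∸-monoˡ-≤ 1 (subst (row x <_) (length-allFin n)
      (filter-notAll (allowed? G w I ∘ (x ,_)) (allFin n)
        (lose (∈-allFin x) λ { (x≢x , _) → x≢x refl })))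

  -- The term with `numLaws G` stands on the right so that no truncation occurs when it exceeds
  -- `n * (n ∸ 1)`.
  imageSize-≥ : ∀ {n} (I : Interpretation d (Fin n)) → (∀ x → ⟦ τ w ⟧ I x ≢ x) →
                n * (n ∸ 1) ≤ numLaws G * n + imageSize G w I
  imageSize-≥ {n} I w≢ = ≤-trans (m≤n+m∸n (n * (n ∸ 1)) (M * n)) (+-monoʳ-≤ (M * n) (begin
    n * (n ∸ 1) ∸ M * n             ≡⟨ cong (n * (n ∸ 1) ∸_) (*-comm M n) ⟩
    n * (n ∸ 1) ∸ n * M             ≡⟨ *-distribˡ-∸ n (n ∸ 1) M ⟨
    n * (n ∸ 1 ∸ M)                 ≡⟨ cong (_* (n ∸ 1 ∸ M)) (length-allFin n) ⟨
    length (allFin n) * (n ∸ 1 ∸ M) ≤⟨ sum-map-≥ row (n ∸ 1 ∸ M) row≥ (allFin n) ⟩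
    sum (map row (allFin n))
      ≡⟨ length-filter-cartesianProduct (allowed? G w I) (allFin n) (allFin n) ⟨
    imageSize G w I                 ∎))
    where
    open ≤-Reasoning
    M : ℕ
    M = numLaws G

    row : Fin n → ℕ
    row x = length (filter (allowed? G w I ∘ (x ,_)) (allFin n))

    -- Outside this list every test holds: the head accounts for `x ≢ y`, the tail for the laws, and
    -- the test on `τ w` holds by hypothesis.
    excluded : Fin n → List (Fin n)
    excluded x = x ∷ map (λ L → ⟦ L ⟧ I x) (laws G)

    length-excluded : ∀ x → length (excluded x) ≡ 1 + M
    length-excluded x = cong suc (trans (length-map _ (laws G)) (length-laws G))

    row≥ : ∀ x → n ∸ 1 ∸ M ≤ row x
    row≥ x = begin
      n ∸ 1 ∸ M   ≡⟨ ∸-+-assoc n 1 M ⟩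
      n ∸ (1 + M) ≤⟨ m≤n+o⇒m∸n≤o n (1 + M) (subst (λ e → n ≤ e + row x) (length-excluded x)
        (length-filter-≥ (allowed? G w I ∘ (x ,_)) (excluded x) λ y∉ →
          (λ x≡y → y∉ (here (sym x≡y))) ,
          All.tabulate (λ L∈ eq → y∉ (there (subst (_∈ _) eq (∈-map⁺ _ L∈)))) ,
          w≢ x)) ⟩
      row x ∎

-- The interpretation by shifts

[k%n+o]%n≡[k+o]%n : ∀ k o n .{{_ : NonZero n}} → (k % n + o) % n ≡ (k + o) % n
[k%n+o]%n≡[k+o]%n k o n = begin
  (k % n + o) % n         ≡⟨ %-distribˡ-+ (k % n) o n ⟩
  (k % n % n + o % n) % n ≡⟨ cong (λ e → (e + o % n) % n) (m%n%n≡m%n k n) ⟩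
  (k % n + o % n) % n     ≡⟨ %-distribˡ-+ k o n ⟨
  (k + o) % n             ∎
  where open ≡-Reasoning

-- Equality would give `k + o ≡ k + (k + o) / n * n`, so `n` would divide `o`, although `0 < o < n`.
[k+o]%n≢k : ∀ {k o n} .{{_ : NonZero n}} .{{_ : NonZero o}} → o < n → (k + o) % n ≢ k
[k+o]%n≢k {k} {o} {n} o<n eq = >⇒∤ o<n
  (subst (n ∣_) (+-cancelˡ-≡ k _ _ (sym k+o≡)) (divides-refl ((k + o) / n)))
  where
  k+o≡ : k + o ≡ k + (k + o) / n * n
  k+o≡ = trans (m≡m%n+[m/n]*n (k + o) n) (cong (_+ (k + o) / n * n) eq)

-- The size has the form `2 + k` so that the residue 1 is available as `suc zero`.
successor : ∀ {d} k → Interpretation d (Fin (2 + k))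
successor k _ = shift (suc zero)

-- A letter and its inverse both shift by 1, so nothing cancels and the total shift counts the
-- letters as written. In the induction the head letter is applied last.
toℕ-successor : ∀ {d} k (w : Word d) x →
  toℕ (⟦ τ w ⟧ (successor k) x) ≡ (toℕ x + length w) % (2 + k)
toℕ-successor k []      x = begin
  toℕ x                 ≡⟨ m<n⇒m%n≡m (toℕ<n x) ⟨
  toℕ x % (2 + k)       ≡⟨ cong (_% (2 + k)) (+-identityʳ (toℕ x)) ⟨
  (toℕ x + 0) % (2 + k) ∎
  where
  open ≡-Reasoning
toℕ-successor k (ℓ ∷ w) x = begin
  toℕ (shift (suc zero) y)                   ≡⟨ toℕ-fromℕ< _ ⟩
  (toℕ y + 1) % n                            ≡⟨ cong (λ e → (e + 1) % n) (toℕ-successor k w x) ⟩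
  ((toℕ x + length w) % n + 1) % n           ≡⟨ [k%n+o]%n≡[k+o]%n (toℕ x + length w) 1 n ⟩
  (toℕ x + length w + 1) % n                 ≡⟨ cong (_% n) (+-assoc (toℕ x) (length w) 1) ⟩
  (toℕ x + (length w + 1)) % n               ≡⟨ cong (λ e → (toℕ x + e) % n) (+-comm (length w) 1) ⟩
  (toℕ x + suc (length w)) % n               ∎
  where
  open ≡-Reasoning
  n = 2 + k
  y = ⟦ τ w ⟧ (successor k) x

successor-fixedPointFree : ∀ {d} k (w : Word d) → w ≢ [] → length w < 2 + k →
  ∀ x → ⟦ τ w ⟧ (successor k) x ≢ x
successor-fixedPointFree k []        w≢[] _   x = contradiction refl w≢[]
successor-fixedPointFree k w@(_ ∷ _) _    w<n x eq =
  [k+o]%n≢k w<n (trans (sym (toℕ-successor k w x)) (cong toℕ eq))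

-- Bounds on the dispersion

module _ (G : Presentation) (w : Word (Presentation.d G)) where
  open Presentation G

  shifts-nearly-optimal : w ≢ [] → ∀ n → length w < n →
    ∃ λ (I : Interpretation d (Fin n)) → (∀ s → IsCyclicShift (I s)) ×
      n * (n ∸ 1) ≤ numLaws G * n + imageSize G w I
  -- On a one-element alphabet every map has a fixed point; here `length w < 1` contradicts
  -- `w ≢ []`.
  shifts-nearly-optimal w≢[] (suc zero)    w<1 = contradiction (length≡0⇒[] w (n<1⇒n≡0 w<1)) w≢[]
    where
    length≡0⇒[] : ∀ (v : Word d) → length v ≡ 0 → v ≡ []
    length≡0⇒[] [] _ = refl
  shifts-nearly-optimal w≢[] (suc (suc k)) w<n =
    successor k , (λ _ → suc zero , λ _ → refl) ,
    imageSize-≥ G w (successor k) (successor-fixedPointFree k w w≢[] w<n)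

  dispersion-≤ : ∀ n → dispersion G w n ≤ n * (n ∸ 1)
  dispersion-≤ n with dispersion-attained G w n
  ... | I , eq = subst (_≤ n * (n ∸ 1)) eq (imageSize-≤ G w I)

  dispersion-≥ : w ≢ [] → ∀ n → length w < n →
                 n * (n ∸ 1) ≤ numLaws G * n + dispersion G w n
  dispersion-≥ w≢[] n w<n with shifts-nearly-optimal w≢[] n w<n
  ... | I , _ , I≥ = ≤-trans I≥ (+-monoʳ-≤ (numLaws G * n) (imageSize≤dispersion G w I))

-- Integer and rational forms of the bounds

k≤n+o⇒+k-+n≤+o : ∀ {k n o} → k ≤ n + o → + k ℤ.- + n ℤ.≤ + o
k≤n+o⇒+k-+n≤+o {k} {n} {o} k≤n+o = begin
  + k ℤ.- + n     ≡⟨ ℤ.m-n≡m⊖n k n ⟩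
  k ℤ.⊖ n         ≤⟨ ℤ.⊖-monoˡ-≤ n k≤n+o ⟩
  (n + o) ℤ.⊖ n   ≡⟨ ℤ.⊖-≥ (m≤m+n n o) ⟩
  + (n + o ∸ n)   ≡⟨ cong +_ (m+n∸m≡n n o) ⟩
  + o             ∎
  where open ℤ.≤-Reasoning

∣+k-+n∣≡n∸k : ∀ {k n} → k ≤ n → ∣ + k ℤ.- + n ∣ ≡ n ∸ k
∣+k-+n∣≡n∸k {k} {n} k≤n = trans (cong ∣_∣ (ℤ.m-n≡m⊖n k n)) (ℤ.∣⊖∣-≤ k≤n)

-- For `k ≤ n` the distance from `k / n` to 1 is `(n ∸ k) / n`, and the comparison with ε becomes an
-- inequality of naturals by cross-multiplication.
∣k/n-1∣<ε : ∀ {k n-1 e b-1} .{c : Coprime (suc e) (suc b-1)} → k ≤ suc n-1 →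
  (suc n-1 ∸ k) * suc b-1 < suc e * suc n-1 →
  ℚ.∣ (+ k ℚ./ suc n-1) ℚ.- 1ℚ ∣ ℚ.< mkℚ +[1+ e ] b-1 c
∣k/n-1∣<ε {k} {n-1} {e} {b-1} k≤n small =
  ℚ.toℚᵘ-cancel-< (ℚᵘ.<-respˡ-≃ (ℚᵘ.≃-sym normal) (*<* cross))
  where
  r : ℚ.ℚ
  r = + k ℚ./ suc n-1

  numerator : ∣ + k ℤ.* + 1 ℤ.+ -1ℤ ℤ.* + suc n-1 ∣ ≡ suc n-1 ∸ k
  numerator = trans
    (cong₂ (λ i j → ∣ i ℤ.+ j ∣) (ℤ.*-identityʳ (+ k)) (ℤ.-1*i≡-i (+ suc n-1)))
    (∣+k-+n∣≡n∸k k≤n)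

  -- The fraction `k / n` is stored in lowest terms, so its numerator and denominator are recovered
  -- only up to equivalence of unnormalised rationals.
  normal : ℚ.toℚᵘ ℚ.∣ r ℚ.- 1ℚ ∣ ℚᵘ.≃ mkℚᵘ (+ (suc n-1 ∸ k)) n-1
  normal = begin
    ℚ.toℚᵘ ℚ.∣ r ℚ.- 1ℚ ∣                   ≈⟨ ℚ.toℚᵘ-homo-∣-∣ (r ℚ.- 1ℚ) ⟩
    ℚᵘ.∣ ℚ.toℚᵘ (r ℚ.- 1ℚ) ∣                ≈⟨ ℚᵘ.∣-∣-cong (ℚ.toℚᵘ-homo-+ r (ℚ.- 1ℚ)) ⟩
    ℚᵘ.∣ ℚ.toℚᵘ r ℚᵘ.- ℚᵘ.1ℚᵘ ∣
      ≈⟨ ℚᵘ.∣-∣-cong (ℚᵘ.+-congˡ (ℚᵘ.- ℚᵘ.1ℚᵘ) (ℚ.toℚᵘ-fromℚᵘ (mkℚᵘ (+ k) n-1))) ⟩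
    ℚᵘ.∣ mkℚᵘ (+ k) n-1 ℚᵘ.- ℚᵘ.1ℚᵘ ∣
      ≈⟨ *≡* (cong₂ (λ u v → + u ℤ.* + v) numerator (sym (*-identityʳ (suc n-1)))) ⟩
    mkℚᵘ (+ (suc n-1 ∸ k)) n-1              ∎
    where open import Relation.Binary.Reasoning.Setoid ℚᵘ.≃-setoid

  cross : + (suc n-1 ∸ k) ℤ.* + suc b-1 ℤ.< +[1+ e ] ℤ.* + suc n-1
  cross = subst₂ ℤ._<_ (ℤ.pos-* (suc n-1 ∸ k) (suc b-1)) (ℤ.pos-* (suc e) (suc n-1)) (+<+ small)

-- The limit and the linear error term

module _ (G : Presentation) (w : Word (Presentation.d G)) (w≢[] : w ≢ []) where

  dispersionRatio⟶1 : dispersionRatio G w ⟶ 1ℚ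
  dispersionRatio⟶1 (mkℚ (+ zero) _ _)   (ℚ.*<* (+<+ ()))
  dispersionRatio⟶1 (mkℚ +[1+ e ] b-1 _) _ =
    -- The summand 2 avoids the default value of the ratio, `length w` ensures `length w < n`, and
    -- `M * suc b-1` makes the error, at most `M / (n ∸ 1)`, smaller than `1 / suc b-1`, hence than
    -- ε.
    2 + (length w + M * suc b-1) , λ { (suc (suc k)) (s≤s (s≤s N≤k)) →
      ∣k/n-1∣<ε (dispersion-≤ G w (2 + k)) (small k N≤k) }
    where
    open ≤-Reasoning
    M : ℕ
    M = numLaws G

    small : ∀ k → length w + M * suc b-1 ≤ k → let n = 2 + k in
            (n * (n ∸ 1) ∸ dispersion G w n) * suc b-1 < suc e * (n * (n ∸ 1))
    small k N≤k = begin-strict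
      (n * (n ∸ 1) ∸ D) * suc b-1
        ≤⟨ *-monoˡ-≤ (suc b-1) (m≤n+o⇒m∸n≤o _ D
             (≤-trans (dispersion-≥ G w w≢[] n w<n) (≤-reflexive (+-comm (M * n) D)))) ⟩
      M * n * suc b-1        ≡⟨ cong (_* suc b-1) (*-comm M n) ⟩
      n * M * suc b-1        ≡⟨ *-assoc n M (suc b-1) ⟩
      n * (M * suc b-1)      <⟨ *-monoʳ-< n (s≤s (m+n≤o⇒n≤o (length w) N≤k)) ⟩
      n * (n ∸ 1)            ≤⟨ m≤n*m (n * (n ∸ 1)) (suc e) ⟩
      suc e * (n * (n ∸ 1))  ∎
      where
      n = 2 + k
      D = dispersion G w n
      w<n : length w < n
      w<n = s≤s (m≤n⇒m≤1+n (m+n≤o⇒m≤o (length w) N≤k))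

  -- Passing from `n * (n ∸ 1)` to `n ^ 2` costs one further `n` beyond the `numLaws G * n` lost to
  -- the laws. The resulting constant depends on `G` alone.
  ∣dispersion-n²∣≤ : ∀ n → length w < n →
    ∣ + dispersion G w n ℤ.- + (n ^ 2) ∣ ≤ (1 + numLaws G) * n
  ∣dispersion-n²∣≤ n@(suc n-1) w<n = begin
    ∣ + D ℤ.- + (n ^ 2) ∣ ≡⟨ ∣+k-+n∣≡n∸k D≤n² ⟩
    n ^ 2 ∸ D             ≤⟨ m≤n+o⇒m∸n≤o (n ^ 2) D n²≤ ⟩
    (1 + M) * n           ∎
    where
    open ≤-Reasoning
    M = numLaws G
    D = dispersion G w n

    n²≡ : n ^ 2 ≡ n + n * n-1
    n²≡ = trans (cong (n *_) (*-identityʳ n)) (*-suc n n-1)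

    D≤n² : D ≤ n ^ 2
    D≤n² = begin
      D           ≤⟨ dispersion-≤ G w n ⟩
      n * n-1     ≤⟨ m≤n+m (n * n-1) n ⟩
      n + n * n-1 ≡⟨ n²≡ ⟨
      n ^ 2       ∎

    n²≤ : n ^ 2 ≤ D + (1 + M) * n
    n²≤ = begin
      n ^ 2           ≡⟨ n²≡ ⟩
      n + n * n-1     ≤⟨ +-monoʳ-≤ n (dispersion-≥ G w w≢[] n w<n) ⟩
      n + (M * n + D) ≡⟨ +-assoc n (M * n) D ⟨
      n + M * n + D   ≡⟨ +-comm (n + M * n) D ⟩
      D + (1 + M) * n ∎

theorem7p1 : (G : Presentation) → let open Presentation G in
    ((w : Word d) → w ≢ [] → (n : ℕ) → length w < n →
    (+ (n * (n ∸ 1)) ℤ.- + (numLaws G * n) ℤ.≤ + dispersion G w n)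
    × (dispersion G w n ≤ n * (n ∸ 1))
    × (∃ λ (I : Interpretation d (Fin n)) →
    (∀ s → IsCyclicShift (I s))
    × (+ (n * (n ∸ 1)) ℤ.- + (numLaws G * n) ℤ.≤ + imageSize G w I)))
    × ((w : Word d) → w ≢ [] → dispersionRatio G w ⟶ 1ℚ)
    × (∃ λ (C : ℕ) → (w : Word d) → w ≢ [] → (n : ℕ) → length w < n →
    ∣ + dispersion G w n ℤ.- + (n ^ 2) ∣ ≤ C * n)
theorem7p1 G =
  (λ w w≢[] n w<n →
    let I , shifts , I≥ = shifts-nearly-optimal G w w≢[] n w<n in
    k≤n+o⇒+k-+n≤+o (dispersion-≥ G w w≢[] n w<n) ,
    dispersion-≤ G w n ,
    I , shifts , k≤n+o⇒+k-+n≤+o I≥) ,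
  dispersionRatio⟶1 G ,
  (1 + numLaws G , ∣dispersion-n²∣≤ G)
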